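{- Let $G$ be a finite simple graph. The following statements are equivalent: 1. $G$ is a closed graph; 2. $G$ has a closed ordering; 3. $G$ has a proper interval ordering; 4. $G$ is a proper interval graph.
   Context: Graphs are finite and simple, with vertex set $V(G)$ and edge set $E(G)$; $[n]=\{1,\ldots,n\}$. Vertex ordering: a vertex ordering (labeling) of an $n$-vertex graph $G$ is a bijection $\sigma: V(G)\to [n]$; write $u<_\sigma v$ if $\sigma(u)<\sigma(v)$, so that the vertices can be listed as $v_1<_\sigma v_2<_\sigma\cdots<_\sigma v_n$. Closed graph: a graph on the vertex set $[n]$ is closed with respect to the given labeling if for all edges $\{i,j\},\{k,\ell\}\in E(G)$ with $i<j$ and $k<\ell$, one has $\{j,\ell\}\in E(G)$ if $i=k$ but $j\neq \ell$, and $\{i,k\}\in E(G)$ if $j=\ell$ but $i\neq k$. A graph $G$ is a closed graph if there exists a labeling of its vertices by $[n]$ for which it is closed. Closed ordering: a vertex ordering $\sigma$ of $G$, with $v_1<_\sigma\cdots<_\sigma v_n$, is closed if for all edges $\{v_i,v_j\}$ and $\{v_k,v_\ell\}$ with $i<j$ and $k<\ell$, one has $\{v_j,v_\ell\}\in E(G)$ if $i=k$ but $j\ne\ell$, and $\{v_i,v_k\}\in E(G)$ if $j=\ell$ but $i\neq k$. Proper interval ordering: a vertex ordering $\sigma$ of $G$ such that for every triple $u,v,w$ of vertices with $u<_\sigma v<_\sigma w$ and $\{u,w\}\in E(G)$, one has $\{u,v\},\{v,w\}\in E(G)$. Interval graph: a graph $G$ such that to each vertex $v\in V(G)$ one can associate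 a closed interval $I_v=[\ell_v,r_v]$ of the real line such that two distinct vertices $u,v$ are adjacent if and only if $I_u\cap I_v\neq\emptyset$; the family $\{I_v\}_{v\in V(G)}$ is an interval representation of $G$. A proper interval graph is a graph having an interval representation in which no interval properly contains another interval of the family. -}

module Defs where

open import Data.Fin.Base using (Fin; _<_)
open import Data.Nat.Base using (ℕ)
open import Data.Product.Base using (Σ; Σ-syntax; ∃-syntax; _×_)
open import Data.Rational.Base using (ℚ) renaming (_<_ to _<ℚ_)
open import Data.Sum.Base using (_⊎_)
open import Function.Base using (_on_)
open import Function.Bundles using (_↔_; _⇔_; Inverse)
open import Level using (0ℓ)
open import Relation.Binary.Core using (Rel)
open import Relation.Binary.Definitions using (Decidable; Irreflexive; Symmetric)
open import Relation.Binary.PropositionalEquality.Core using (_≡_; _≢_; cong)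
open import Relation.Nullary.Negation.Core using (¬_)
open import Relation.Unary using (Pred; _∈_; _⊆_; _⊂_; _≬_; Satisfiable)

-- {u , v} ∈ E(G) is rendered by the symmetric relation Adj u v.
record SimpleGraph (V : Set) : Set₁ where
  field
    Adj    : Rel V 0ℓ
    adj?   : Decidable Adj
    sym    : Symmetric Adj
    irrefl : Irreflexive _≡_ Adj

record FiniteSimpleGraph : Set₁ where
  field
    V           : Set
    order       : ℕ
    enumeration : V ↔ Fin order
    graph       : SimpleGraph V

  open SimpleGraph graph public

-- [n] is Fin n, so labels start at 0 instead of 1.
VertexOrdering : FiniteSimpleGraph → Set
VertexOrdering G = V ↔ Fin order
  where open FiniteSimpleGraph G

module _ (G : FiniteSimpleGraph) (σ : VertexOrdering G) where
  open FiniteSimpleGraph G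

  precedes : Rel V 0ℓ
  precedes = _<_ on Inverse.to σ

  -- vertexAt i is the vertex vᵢ in the list v₁ <σ v₂ <σ ⋯ <σ vₙ.
  vertexAt : Fin order → V
  vertexAt = Inverse.from σ

  -- G transported to the vertex set [n] along the labeling σ.
  relabel : SimpleGraph (Fin order)
  relabel = record
    { Adj    = Adj on vertexAt
    ; adj?   = λ i j → adj? (vertexAt i) (vertexAt j)
    ; sym    = sym
    ; irrefl = λ i≡j → irrefl (cong vertexAt i≡j)
    }

IsClosedForLabeling : ∀ {n} → SimpleGraph (Fin n) → Set
IsClosedForLabeling H =
  ∀ i j k l → Adj i j → Adj k l → i < j → k < l →
    (i ≡ k → j ≢ l → Adj j l) × (j ≡ l → i ≢ k → Adj i k)
  where open SimpleGraph H

IsClosedGraph : FiniteSimpleGraph → Set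
IsClosedGraph G = Σ[ σ ∈ VertexOrdering G ] IsClosedForLabeling (relabel G σ)

IsClosedOrdering : (G : FiniteSimpleGraph) → VertexOrdering G → Set
IsClosedOrdering G σ =
  ∀ i j k l → Adj (v i) (v j) → Adj (v k) (v l) → i < j → k < l →
    (i ≡ k → j ≢ l → Adj (v j) (v l)) × (j ≡ l → i ≢ k → Adj (v i) (v k))
  where
  open FiniteSimpleGraph G
  v = vertexAt G σ

IsProperIntervalOrdering : (G : FiniteSimpleGraph) → VertexOrdering G → Set
IsProperIntervalOrdering G σ =
  ∀ u v w → u <σ v → v <σ w → Adj u w → Adj u v × Adj v w
  where
  open FiniteSimpleGraph G
  _<σ_ = precedes G σ

HasClosedOrdering : FiniteSimpleGraph → Set
HasClosedOrdering G = Σ[ σ ∈ VertexOrdering G ] IsClosedOrdering G σ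

HasProperIntervalOrdering : FiniteSimpleGraph → Set
HasProperIntervalOrdering G =
  Σ[ σ ∈ VertexOrdering G ] IsProperIntervalOrdering G σ

-- Two-sided Dedekind cuts: L is {q | q < x} and U is {q | x < q}.
record ℝ : Set₁ where
  field
    L U         : Pred ℚ 0ℓ
    L-inhabited : Satisfiable L
    U-inhabited : Satisfiable U
    L-lower     : ∀ {p q} → p <ℚ q → q ∈ L → p ∈ L
    U-upper     : ∀ {p q} → p <ℚ q → p ∈ U → q ∈ U
    L-open      : ∀ {p} → p ∈ L → ∃[ q ] p <ℚ q × q ∈ L
    U-open      : ∀ {q} → q ∈ U → ∃[ p ] p <ℚ q × p ∈ U
    disjoint    : ∀ {q} → ¬ (q ∈ L × q ∈ U)
    located     : ∀ {p q} → p <ℚ q → p ∈ L ⊎ q ∈ U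

infix 4 _≤_

_≤_ : Rel ℝ 0ℓ
x ≤ y = ℝ.L x ⊆ ℝ.L y

ClosedInterval : ℝ → ℝ → Pred ℝ 0ℓ
ClosedInterval a b x = a ≤ x × x ≤ b

record IntervalRepresentation (G : FiniteSimpleGraph) : Set₁ where
  open FiniteSimpleGraph G
  field
    left right : V → ℝ
    left≤right : ∀ v → left v ≤ right v

  I : V → Pred ℝ 0ℓ
  I v = ClosedInterval (left v) (right v)

  field
    adjacent⇔intersect : ∀ {u v} → u ≢ v → Adj u v ⇔ (I u ≬ I v)

IsProper : ∀ {G} → IntervalRepresentation G → Set₁
IsProper R = ∀ u v → ¬ (I u ⊂ I v)
  where open IntervalRepresentation R

IsProperIntervalGraph : FiniteSimpleGraph → Set₁
IsProperIntervalGraph G = Σ (IntervalRepresentation G) IsProper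

{-# OPTIONS --safe #-}
module Submission where

-- (2 ⇒ 3) A closed ordering of a disconnected graph need not be a proper interval
-- ordering, because its components may be interleaved.  In a closed labeling two
-- vertices of the same component are joined by an increasing path, so whenever
-- i < j < k lie in one component and i ~ k, every vertex of an increasing path from
-- i to j is adjacent to k; hence j ~ k, and then i ~ j.  Listing the components one
-- after another, each in the given order, is therefore a proper interval ordering.
--
-- (4 ⇒ 3) In a proper representation, the orders by left and by right endpoints agree.
-- Real endpoints cannot be compared constructively, but the existence of a proper
-- interval ordering is a decidable property of a finite graph, so its double negation
-- suffices, and under a double negation finitely many comparisons may be decided.

open import Data.Empty using (⊥-elim)
open import Data.Fin.Base as Fin using (Fin; toℕ; cast; combine; finToFun; funToFin; _<_)
open import Data.Fin.Permutation using (cast-id)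
open import Data.Fin.Properties as Fin using (toℕ<n; toℕ-injective; toℕ-cast; toℕ-combine; combine-monoˡ-<; finToFun-funToFin; nonZeroIndex; sequence; all?; any?; <-cmp)
open import Data.Integer.Base using (+_; +≤+)
import Data.Integer.Properties as ℤ
open import Data.List.Base using (List; allFin; filter; length; lookup; tabulate)
import Data.List.Extrema as Extrema
open import Data.List.Membership.Propositional.Properties using (∈-allFin; ∈-filter⁺; ∈-filter⁻)
open import Data.List.Properties using (length-tabulate; lookup-tabulate)
open import Data.List.Relation.Binary.Permutation.Propositional using (↭⇒↭ₛ)
open import Data.List.Relation.Binary.Permutation.Propositional.Properties using (↭-length)
import Data.List.Relation.Binary.Permutation.Setoid as PermutationSetoid
import Data.List.Relation.Binary.Permutation.Setoid.Properties as PermutationSetoidProperties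
import Data.List.Relation.Unary.All as All
open import Data.List.Relation.Unary.Sorted.TotalOrder.Properties using (lookup-mono-≤)
import Data.List.Sort as Sort
open import Data.Nat.Base as ℕ using (ℕ)
import Data.Nat.Coprimality as Coprimality
import Data.Nat.Properties as ℕ
open import Data.Product.Base using (Σ-syntax; ∃; ∃-syntax; _×_; _,_; proj₁; proj₂; swap)
open import Data.Rational.Base as ℚ using (ℚ; mkℚ; 1ℚ)
import Data.Rational.Properties as ℚ
open import Data.Sum.Base as Sum using (_⊎_; inj₁; inj₂; [_,_]′)
open import Effect.Monad using (RawMonad)
open import Function.Base using (_∘_; _on_; id)
open import Function.Bundles using (_↔_; _⇔_; mk⇔; mk↔ₛ′; Inverse; Injection; Equivalence)
open import Function.Construct.Composition using (_↔-∘_)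
open import Function.Construct.Identity using (↔-id)
open import Function.Construct.Symmetry using (↔-sym)
open import Function.Properties.Inverse using (↔⇒↣)
open import Level using (0ℓ)
open import Relation.Binary.Bundles using (DecTotalOrder; TotalOrder)
open import Relation.Binary.Core using (Rel)
open import Relation.Binary.Construct.Closure.ReflexiveTransitive using (Star; ε; _◅_; _◅◅_; reverse)
import Relation.Binary.Construct.Flip.EqAndOrd as Flip
open import Relation.Binary.Definitions using (Decidable; Total; Transitive; tri<; tri≈; tri>)
open import Relation.Binary.PropositionalEquality using (_≡_; _≢_; refl; sym; trans; cong; subst; subst₂; setoid; module ≡-Reasoning)
open import Relation.Binary.Structures using (IsTotalOrder)
open import Relation.Nullary.Decidable using (Dec; yes; no; map′; decidable-stable; ¬¬-excluded-middle; _×-dec_; _⊎-dec_; _→-dec_)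
open import Relation.Nullary.Negation using (¬_; contradiction; ¬¬-Monad; ¬¬-map)
open import Relation.Unary using (Pred; _≬_) renaming (Decidable to Decidable₁)
open import Defs

private
  variable
    n : ℕ
    A : Set

-- Finite types

module Finite (e : A ↔ Fin n) where
  open Inverse e

  ∀-from : {P : Pred A 0ℓ} → (∀ i → P (from i)) → ∀ x → P x
  ∀-from {P} h x = subst P (strictlyInverseʳ x) (h (to x))

  ∀? : {P : Pred A 0ℓ} → Decidable₁ P → Dec (∀ x → P x)
  ∀? P? = map′ ∀-from (λ h i → h (from i)) (all? (λ i → P? (from i)))

  -- Finiteness is what makes this work: double negation commutes with finite conjunctions, but
  -- constructively not with infinite ones in general.
  ¬¬-∀ : {P : Pred A 0ℓ} → (∀ x → ¬ ¬ P x) → ¬ ¬ (∀ x → P x)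
  ¬¬-∀ h = ¬¬-map ∀-from
    (sequence (RawMonad.rawApplicative ¬¬-Monad) (λ i → h (from i)))

  ¬¬-decidable : (R : Rel A 0ℓ) → ¬ ¬ Decidable R
  ¬¬-decidable R = ¬¬-∀ (λ x → ¬¬-∀ (λ y → ¬¬-excluded-middle))

extremum : {_⊑_ : Rel (Fin n) 0ℓ} → IsTotalOrder _≡_ _⊑_ →
  {P : Pred (Fin n) 0ℓ} → Decidable₁ P → ∃ P →
  ∃[ m ] P m × (∀ k → P k → m ⊑ k)
extremum {n} {_⊑_} O {P} P? (i , pi) =
  -- The default `i` itself satisfies `P`, so `P` holds of the minimum whether the default or a
  -- candidate is selected.
  min i candidates ,
  [ (λ eq → subst P (sym eq) pi) , (λ m∈ → proj₂ (∈-filter⁻ P? {xs = allFin n} m∈)) ]′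
    (argmin-sel id i candidates) ,
  λ k pk → All.lookup (min≤xs i candidates) (∈-filter⁺ P? (∈-allFin k) pk)
  where
  order : TotalOrder 0ℓ 0ℓ 0ℓ
  order = record { isTotalOrder = O }
  open Extrema order

  candidates : List (Fin n)
  candidates = filter P? (allFin n)

least : {P : Pred (Fin n) 0ℓ} → Decidable₁ P → ∃ P →
  ∃[ m ] P m × (∀ k → P k → m Fin.≤ k)
least = extremum Fin.≤-isTotalOrder

greatest : {P : Pred (Fin n) 0ℓ} → Decidable₁ P → ∃ P →
  ∃[ m ] P m × (∀ k → P k → k Fin.≤ m)
greatest = extremum (Flip.isTotalOrder Fin.≤-isTotalOrder)

-- Sorting along a total preorder

module _ {_≼_ : Rel A 0ℓ}
  (≼? : Decidable _≼_) (total : Total _≼_) (≼-trans : Transitive _≼_) where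

  private
    ≼-refl : ∀ {x} → x ≼ x
    ≼-refl {x} = [ id , id ]′ (total x x)

    -- Taking mutual `≼` as the equality turns the preorder into a total order, antisymmetry being
    -- mere pairing.
    order : DecTotalOrder 0ℓ 0ℓ 0ℓ
    order = record
      { _≈_ = λ x y → x ≼ y × y ≼ x
      ; isDecTotalOrder = record
        { isTotalOrder = record
          { isPartialOrder = record
            { isPreorder = record
              { isEquivalence = record
                { refl = ≼-refl , ≼-refl
                ; sym = swap
                ; trans = λ (p , q) (r , s) → ≼-trans p r , ≼-trans s q
                }
              ; reflexive = proj₁
              ; trans = ≼-trans
              }
            ; antisym = _,_
            }
          ; total = total
          }
        ; _≟_ = λ x y → ≼? x y ×-dec ≼? y x
        ; _≤?_ = ≼?
        }
      }

  -- The permutation between a list and its sorted version acts on positions, which makes sorting a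
  -- bijection; ties in `≼` are broken by the sort.
  sorting : A ↔ Fin n →
    Σ[ σ ∈ A ↔ Fin n ] (∀ u v → Inverse.to σ u < Inverse.to σ v → u ≼ v)
  sorting {n} e = σ , λ u v u<v → subst₂ _≼_ (at u) (at v)
    (lookup-mono-≤ (DecTotalOrder.totalOrder order) (sort-↗ xs)
      (ℕ.<⇒≤ (subst₂ ℕ._<_ (toℕ-cast _ _) (toℕ-cast _ _) u<v)))
    where
    open Sort order
    open PermutationSetoid (setoid A) using (onIndices)
    open PermutationSetoidProperties (setoid A) using (onIndices-lookup)
    module E = Inverse e

    xs : List A
    xs = tabulate E.from

    π : Fin (length (sort xs)) ↔ Fin (length xs)
    π = onIndices (↭⇒↭ₛ (sort-↭ xs))

    index : A ↔ Fin (length (sort xs))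
    index = ↔-sym π ↔-∘ (cast-id (sym (length-tabulate E.from)) ↔-∘ e)

    σ : A ↔ Fin n
    σ = cast-id (trans (↭-length (sort-↭ xs)) (length-tabulate E.from)) ↔-∘ index

    at : ∀ u → lookup (sort xs) (Inverse.to index u) ≡ u
    at u = begin
      lookup (sort xs) (Inverse.from π j) ≡⟨ onIndices-lookup (↭⇒↭ₛ (sort-↭ xs)) _ ⟩
      lookup xs (Inverse.to π (Inverse.from π j)) ≡⟨ cong (lookup xs) (Inverse.strictlyInverseˡ π j) ⟩
      lookup xs j ≡⟨ lookup-tabulate E.from (E.to u) ⟩
      E.from (E.to u) ≡⟨ E.strictlyInverseʳ u ⟩
      u ∎
      where
      open ≡-Reasoning
      j = cast (sym (length-tabulate E.from)) (E.to u)

-- Proper interval orderings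

module _ (G : FiniteSimpleGraph) where
  open FiniteSimpleGraph G
  open Finite enumeration
  private
    module E = Inverse enumeration

    -- An ordering is coded by mutually inverse functions on indices. There are finitely many such
    -- pairs, so existence can be decided by exhaustive search.
    IsOrderingCode : (Fin order → Fin order) → (Fin order → Fin order) → Set
    IsOrderingCode f g =
      (∀ i → f (g i) ≡ i) × (∀ i → g (f i) ≡ i) ×
      (∀ u v w → f (E.to u) < f (E.to v) → f (E.to v) < f (E.to w) →
        Adj u w → Adj u v × Adj v w)

    isOrderingCode? : ∀ f g → Dec (IsOrderingCode f g)
    isOrderingCode? f g =
      all? (λ i → f (g i) Fin.≟ i) ×-dec all? (λ i → g (f i) Fin.≟ i) ×-dec
      ∀? (λ u → ∀? (λ v → ∀? (λ w →
        (f (E.to u) Fin.<? f (E.to v)) →-dec (f (E.to v) Fin.<? f (E.to w)) →-dec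
        adj? u w →-dec adj? u v ×-dec adj? v w)))

    decode : ∀ f g → IsOrderingCode f g → HasProperIntervalOrdering G
    decode f g (fg , gf , pio) = mk↔ₛ′ f g fg gf ↔-∘ enumeration , pio

    -- Only pointwise agreement is assumed, since `finToFun` recovers a function from its number
    -- only pointwise.
    encode : (o : HasProperIntervalOrdering G) → let σ = proj₁ o in
      ∀ f g → (∀ i → f i ≡ Inverse.to σ (E.from i)) →
              (∀ i → g i ≡ E.to (Inverse.from σ i)) → IsOrderingCode f g
    encode (σ , pio) f g f≗ g≗ =
      (λ i → begin
        f (g i) ≡⟨ f≗ (g i) ⟩
        S.to (E.from (g i)) ≡⟨ cong (S.to ∘ E.from) (g≗ i) ⟩
        S.to (E.from (E.to (S.from i))) ≡⟨ cong S.to (E.strictlyInverseʳ _) ⟩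
        S.to (S.from i) ≡⟨ S.strictlyInverseˡ i ⟩
        i ∎) ,
      (λ i → begin
        g (f i) ≡⟨ g≗ (f i) ⟩
        E.to (S.from (f i)) ≡⟨ cong (E.to ∘ S.from) (f≗ i) ⟩
        E.to (S.from (S.to (E.from i))) ≡⟨ cong E.to (S.strictlyInverseʳ _) ⟩
        E.to (E.from i) ≡⟨ E.strictlyInverseˡ i ⟩
        i ∎) ,
      λ u v w u<v v<w → pio u v w
        (subst₂ _<_ (position u) (position v) u<v)
        (subst₂ _<_ (position v) (position w) v<w)
      where
      module S = Inverse σ
      open ≡-Reasoning

      position : ∀ u → f (E.to u) ≡ S.to u
      position u = trans (f≗ (E.to u)) (cong S.to (E.strictlyInverseʳ u))

  hasProperIntervalOrdering? : Dec (HasProperIntervalOrdering G)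
  hasProperIntervalOrdering? = map′
    (λ (a , b , code) → decode (finToFun a) (finToFun b) code)
    (λ o → funToFin {order} _ , funToFin {order} _ ,
      encode o _ _ (finToFun-funToFin _) (finToFun-funToFin _))
    (any? λ a → any? λ b → isOrderingCode? (finToFun a) (finToFun b))

  ¬¬⇒hasProperIntervalOrdering :
    ¬ ¬ HasProperIntervalOrdering G → HasProperIntervalOrdering G
  ¬¬⇒hasProperIntervalOrdering = decidable-stable hasProperIntervalOrdering?

  -- The common last step of (2 ⇒ 3) and (4 ⇒ 3). Sorting may break ties either way, so betweenness
  -- is required for `≼` rather than for a strict order.
  preorder⇒properIntervalOrdering : {_≼_ : Rel V 0ℓ} →
    Decidable _≼_ → Total _≼_ → Transitive _≼_ →
    (∀ u v w → u ≢ v → v ≢ w → u ≼ v → v ≼ w → Adj u w → Adj u v × Adj v w) →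
    HasProperIntervalOrdering G
  preorder⇒properIntervalOrdering ≼? total ≼-trans h =
    let σ , mono = sorting ≼? total ≼-trans enumeration
        <⇒≢ : ∀ {u v} → precedes G σ u v → u ≢ v
        <⇒≢ u<v u≡v = ℕ.<-irrefl (cong (toℕ ∘ Inverse.to σ) u≡v) u<v
    in σ , λ u v w u<v v<w →
      h u v w (<⇒≢ u<v) (<⇒≢ v<w) (mono u v u<v) (mono v w v<w)

-- Closed orderings

-- When two edges share an end on the same side, betweenness applies to the longer one, with the
-- free end of the shorter as middle vertex.
properIntervalOrdering⇒closed : ∀ G → HasProperIntervalOrdering G → HasClosedOrdering G
properIntervalOrdering⇒closed G (σ , pio) = σ , λ i j k l i~j k~l i<j k<l →
  (λ { refl j≢l → [ (λ j<l → proj₂ (pio′ i<j j<l k~l))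
                  , (λ l<j → G.sym (proj₂ (pio′ k<l l<j i~j))) ]′ (≢⇒<⊎> j≢l) }) ,
  (λ { refl i≢k → [ (λ i<k → proj₁ (pio′ i<k k<l i~j))
                  , (λ k<i → G.sym (proj₁ (pio′ k<i i<j k~l))) ]′ (≢⇒<⊎> i≢k) })
  where
  module G = FiniteSimpleGraph G
  module S = Inverse σ

  pio′ : ∀ {i j k} → i < j → j < k → G.Adj (S.from i) (S.from k) →
    G.Adj (S.from i) (S.from j) × G.Adj (S.from j) (S.from k)
  pio′ {i} {j} {k} i<j j<k = pio _ _ _
    (subst₂ _<_ (sym (S.strictlyInverseˡ i)) (sym (S.strictlyInverseˡ j)) i<j)
    (subst₂ _<_ (sym (S.strictlyInverseˡ j)) (sym (S.strictlyInverseˡ k)) j<k)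

  ≢⇒<⊎> : ∀ {i j : Fin G.order} → i ≢ j → i < j ⊎ j < i
  ≢⇒<⊎> {i} {j} i≢j with <-cmp i j
  ... | tri< i<j _ _ = inj₁ i<j
  ... | tri≈ _ i≡j _ = contradiction i≡j i≢j
  ... | tri> _ _ j<i = inj₂ j<i

-- Paths in a relation with comparable siblings

module _ {T : Rel A 0ℓ}
  (siblings : ∀ {i j k} → T i j → T i k → j ≡ k ⊎ (T j k ⊎ T k j)) where

  -- The single step is pushed along the path: `siblings` either moves its source one vertex further
  -- or joins its target to the rest of the path.
  fork-step : ∀ {i j k} → Star T i j → T i k → Star T j k ⊎ Star T k j
  fork-step ε k = inj₁ (k ◅ ε)
  fork-step (m ◅ ms) k with siblings m k
  ... | inj₁ refl      = inj₂ ms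
  ... | inj₂ (inj₁ mk) = fork-step ms mk
  ... | inj₂ (inj₂ km) = inj₂ (km ◅ ms)

  fork : ∀ {i j k} → Star T i j → Star T i k → Star T j k ⊎ Star T k j
  fork p ε = inj₂ p
  fork p (k ◅ ks) with fork-step p k
  ... | inj₁ q = inj₁ (q ◅◅ ks)
  ... | inj₂ q = fork q ks

module ClosedLabeling (H : SimpleGraph (Fin n)) (closed : IsClosedForLabeling H) where
  open SimpleGraph H renaming (sym to Adj-sym)

  _↗_ _⟶_ _≈_ : Rel (Fin n) 0ℓ
  i ↗ j = Adj i j × i < j
  _⟶_ = Star _↗_
  -- In a closed labeling this is the relation of lying in the same component.
  i ≈ j = i ⟶ j ⊎ j ⟶ i

  private
    compare : ∀ {j k} → (j ≢ k → Adj j k) → j ≡ k ⊎ (j ↗ k ⊎ k ↗ j)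
    compare {j} {k} h with <-cmp j k
    ... | tri< j<k j≢k _ = inj₂ (inj₁ (h j≢k , j<k))
    ... | tri≈ _ j≡k _   = inj₁ j≡k
    ... | tri> _ j≢k k<j = inj₂ (inj₂ (Adj-sym (h j≢k) , k<j))

  siblings↗ : ∀ {i j k} → i ↗ j → i ↗ k → j ≡ k ⊎ (j ↗ k ⊎ k ↗ j)
  siblings↗ (i~j , i<j) (i~k , i<k) =
    compare (proj₁ (closed _ _ _ _ i~j i~k i<j i<k) refl)

  -- Phrased so that `fork` also applies to the converse of `_↗_`.
  siblings↙ : ∀ {i j k} → j ↗ i → k ↗ i → j ≡ k ⊎ (k ↗ j ⊎ j ↗ k)
  siblings↙ (j~i , j<i) (k~i , k<i) =
    Sum.map₂ Sum.swap (compare (proj₂ (closed _ _ _ _ j~i k~i j<i k<i) refl))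

  ≈-refl : ∀ {i} → i ≈ i
  ≈-refl = inj₁ ε

  ≈-sym : ∀ {i j} → i ≈ j → j ≈ i
  ≈-sym = Sum.swap

  -- The mixed cases carry the content: two increasing paths with a common top or a common bottom
  -- have free ends joined by an increasing path.
  ≈-trans : ∀ {i j k} → i ≈ j → j ≈ k → i ≈ k
  ≈-trans (inj₁ p) (inj₁ q) = inj₁ (p ◅◅ q)
  ≈-trans (inj₁ p) (inj₂ q) =
    Sum.swap (Sum.map (reverse id) (reverse id)
      (fork siblings↙ (reverse id p) (reverse id q)))
  ≈-trans (inj₂ p) (inj₁ q) = fork siblings↗ p q
  ≈-trans (inj₂ p) (inj₂ q) = inj₂ (q ◅◅ p)

  ⟶⇒≤ : ∀ {i j} → i ⟶ j → i Fin.≤ j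
  ⟶⇒≤ ε = ℕ.≤-refl
  ⟶⇒≤ ((_ , i<j) ◅ p) = ℕ.≤-trans (ℕ.<⇒≤ i<j) (⟶⇒≤ p)

  -- Adjacency to `k` passes along each step: the edges from `i` to `m` and to `k` share their
  -- smaller end. The path increases, so `m` stays below `k`.
  ⟶-below-neighbour : ∀ {i j k} → i ⟶ j → j < k → Adj i k → Adj j k
  ⟶-below-neighbour ε _ i~k = i~k
  ⟶-below-neighbour ((i~m , i<m) ◅ p) j<k i~k =
    ⟶-below-neighbour p j<k
      (proj₁ (closed _ _ _ _ i~m i~k i<m (ℕ.<-trans i<m m<k)) refl (Fin.<⇒≢ m<k))
    where m<k = ℕ.≤-<-trans (⟶⇒≤ p) j<k

  proper-within-component : ∀ {i j k} → i ≈ j → i < j → j < k →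
    Adj i k → Adj i j × Adj j k
  proper-within-component (inj₂ p) i<j _ _ = contradiction i<j (ℕ.≤⇒≯ (⟶⇒≤ p))
  proper-within-component (inj₁ p) i<j j<k i~k =
    proj₂ (closed _ _ _ _ i~k j~k (ℕ.<-trans i<j j<k) j<k) refl (Fin.<⇒≢ i<j) , j~k
    where j~k = ⟶-below-neighbour p j<k i~k

  module Components (≈? : Decidable _≈_) where

    private
      -- The least label of a component is a canonical representative, so that `≈` becomes equality
      -- of roots.
      leastEquivalent : ∀ i → ∃[ m ] i ≈ m × (∀ k → i ≈ k → m Fin.≤ k)
      leastEquivalent i = least (≈? i) (i , ≈-refl)

    root : Fin n → Fin n
    root i = proj₁ (leastEquivalent i)

    ≈-root : ∀ i → i ≈ root i
    ≈-root i = proj₁ (proj₂ (leastEquivalent i))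

    root-least : ∀ i k → i ≈ k → root i Fin.≤ k
    root-least i = proj₂ (proj₂ (leastEquivalent i))

    ≈⇒root≡ : ∀ {i j} → i ≈ j → root i ≡ root j
    ≈⇒root≡ {i} {j} i≈j = Fin.≤-antisym
      (root-least i _ (≈-trans i≈j (≈-root j)))
      (root-least j _ (≈-trans (≈-sym i≈j) (≈-root i)))

    root≡⇒≈ : ∀ {i j} → root i ≡ root j → i ≈ j
    root≡⇒≈ {i} {j} eq =
      ≈-trans (≈-root i) (subst (_≈ j) (sym eq) (≈-sym (≈-root j)))

    Adj⇒≈ : ∀ {i j} → Adj i j → i ≈ j
    Adj⇒≈ {i} {j} i~j with compare {i} {j} (λ _ → i~j)
    ... | inj₁ refl     = ≈-refl
    ... | inj₂ (inj₁ e) = inj₁ (e ◅ ε)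
    ... | inj₂ (inj₂ e) = inj₂ (e ◅ ε)

    -- Sorting by this key lists the components one after another.
    key : Fin n → Fin (n ℕ.* n)
    key i = combine (root i) i

    key≤⇒root≤ : ∀ i j → key i Fin.≤ key j → root i Fin.≤ root j
    key≤⇒root≤ i j ki≤kj =
      ℕ.≮⇒≥ λ rj<ri → ℕ.<⇒≱ (combine-monoˡ-< j i rj<ri) ki≤kj

    key≤⇒≤ : ∀ i j → root i ≡ root j → key i Fin.≤ key j → i Fin.≤ j
    key≤⇒≤ i j eq ki≤kj = ℕ.+-cancelˡ-≤ (n ℕ.* toℕ (root j)) _ _
      (subst₂ ℕ._≤_
        (trans (toℕ-combine (root i) i) (cong (λ r → n ℕ.* toℕ r ℕ.+ toℕ i) eq))
        (toℕ-combine (root j) j) ki≤kj)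

    -- The adjacent ends share a root and keys are ordered by root first, so the middle vertex is
    -- squeezed into the same component, where key order is label order.
    key-proper : ∀ {i j k} → i ≢ j → j ≢ k → key i Fin.≤ key j → key j Fin.≤ key k →
      Adj i k → Adj i j × Adj j k
    key-proper {i} {j} {k} i≢j j≢k ki≤kj kj≤kk i~k =
      proper-within-component (root≡⇒≈ ri≡rj)
        (ℕ.≤∧≢⇒< (key≤⇒≤ i j ri≡rj ki≤kj) (i≢j ∘ toℕ-injective))
        (ℕ.≤∧≢⇒< (key≤⇒≤ j k (trans (sym ri≡rj) ri≡rk) kj≤kk) (j≢k ∘ toℕ-injective))
        i~k
      where
      ri≡rk : root i ≡ root k
      ri≡rk = ≈⇒root≡ (Adj⇒≈ i~k)

      ri≡rj : root i ≡ root j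
      ri≡rj = Fin.≤-antisym (key≤⇒root≤ i j ki≤kj)
        (subst (root j Fin.≤_) (sym ri≡rk) (key≤⇒root≤ j k kj≤kk))

closed⇒properIntervalOrdering : ∀ G → HasClosedOrdering G → HasProperIntervalOrdering G
closed⇒properIntervalOrdering G (σ , closed) =
  -- The goal is stable under double negation, so `_≈_` may be assumed decidable without an
  -- algorithm for reachability.
  ¬¬⇒hasProperIntervalOrdering G
    (¬¬-map fromDecidable (Finite.¬¬-decidable (↔-id (Fin order)) _≈_))
  where
  open FiniteSimpleGraph G hiding (sym)
  open ClosedLabeling (relabel G σ) closed
  module S = Inverse σ

  fromDecidable : Decidable _≈_ → HasProperIntervalOrdering G
  fromDecidable ≈? = preorder⇒properIntervalOrdering G {Fin._≤_ on (key ∘ S.to)}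
    (λ u v → key (S.to u) Fin.≤? key (S.to v))
    (λ u v → Fin.≤-total (key (S.to u)) (key (S.to v)))
    ℕ.≤-trans
    (λ u v w u≢v v≢w u≼v v≼w u~w →
      let i~j , j~k = key-proper (u≢v ∘ to-injective) (v≢w ∘ to-injective) u≼v v≼w
                        (subst₂ Adj (sym (S.strictlyInverseʳ u)) (sym (S.strictlyInverseʳ w)) u~w)
      in subst₂ Adj (S.strictlyInverseʳ u) (S.strictlyInverseʳ v) i~j ,
         subst₂ Adj (S.strictlyInverseʳ v) (S.strictlyInverseʳ w) j~k)
    where
    open Components ≈?
    to-injective : ∀ {u v} → S.to u ≡ S.to v → u ≡ v
    to-injective = Injection.injective (↔⇒↣ σ)

-- Real numbers

≤-refl : ∀ x → x ≤ x
≤-refl x q∈ = q∈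

≤-trans : ∀ x y z → x ≤ y → y ≤ z → x ≤ z
≤-trans x y z x≤y y≤z q∈ = y≤z (x≤y q∈)

-- Locatedness replaces decidable comparison: for `q < q′` below `y`, either `q` is below `x`, or
-- `x` is below `q′` and hence below `y`, which is excluded.
≰⇒≥ : ∀ x y → ¬ (x ≤ y) → y ≤ x
≰⇒≥ x y x≰y q∈Ly with ℝ.L-open y q∈Ly
... | q′ , q<q′ , q′∈Ly with ℝ.located x q<q′
...   | inj₁ q∈Lx = q∈Lx
...   | inj₂ q′∈Ux = ⊥-elim (x≰y below)
  where
  below : x ≤ y
  below {p} p∈Lx with ℚ.<-cmp p q′
  ... | tri< p<q′ _ _ = ℝ.L-lower y p<q′ q′∈Ly
  ... | tri≈ _ refl _ = q′∈Ly
  ... | tri> _ _ q′<p = contradiction (ℝ.L-lower x q′<p p∈Lx , q′∈Ux) (ℝ.disjoint x)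

fromℚ : ℚ → ℝ
fromℚ r = record
  { L = ℚ._< r
  ; U = r ℚ.<_
  ; L-inhabited = r ℚ.- 1ℚ ,
      subst (r ℚ.- 1ℚ ℚ.<_) (ℚ.+-identityʳ r) (ℚ.+-monoʳ-< r (ℚ.negative⁻¹ (ℚ.- 1ℚ)))
  ; U-inhabited = r ℚ.+ 1ℚ ,
      subst (ℚ._< r ℚ.+ 1ℚ) (ℚ.+-identityʳ r) (ℚ.+-monoʳ-< r (ℚ.positive⁻¹ 1ℚ))
  ; L-lower = ℚ.<-trans
  ; U-upper = λ p<q r<p → ℚ.<-trans r<p p<q
  ; L-open = ℚ.<-dense
  ; U-open = λ r<q → let p , r<p , p<q = ℚ.<-dense r<q in p , p<q , r<p
  ; disjoint = λ (q<r , r<q) → ℚ.<-asym q<r r<q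
  ; located = λ {p} {q} → located p q
  }
  where
  located : ∀ p q → p ℚ.< q → p ℚ.< r ⊎ r ℚ.< q
  located p q p<q with p ℚ.<? r
  ... | yes p<r = inj₁ p<r
  ... | no p≮r = inj₂ (ℚ.≤-<-trans (ℚ.≮⇒≥ p≮r) p<q)

fromℚ-mono-≤ : ∀ {p q} → p ℚ.≤ q → fromℚ p ≤ fromℚ q
fromℚ-mono-≤ p≤q r<p = ℚ.<-≤-trans r<p p≤q

fromℚ-cancel-≤ : ∀ {p q} → fromℚ p ≤ fromℚ q → p ℚ.≤ q
fromℚ-cancel-≤ h = ℚ.≮⇒≥ λ q<p → ℚ.<-irrefl refl (h q<p)

-- The fraction is given in lowest terms, the `0` being the denominator minus one; comparisons then
-- reduce to integers multiplied by 1.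
fromℕ : ℕ → ℝ
fromℕ m = fromℚ (mkℚ (+ m) 0 (Coprimality.sym (Coprimality.1-coprimeTo m)))

fromℕ-mono-≤ : ∀ {m k} → m ℕ.≤ k → fromℕ m ≤ fromℕ k
fromℕ-mono-≤ m≤k = fromℚ-mono-≤ (ℚ.*≤* (ℤ.*-monoʳ-≤-nonNeg (+ 1) (+≤+ m≤k)))

fromℕ-cancel-≤ : ∀ {m k} → fromℕ m ≤ fromℕ k → m ℕ.≤ k
fromℕ-cancel-≤ {m} {k} h = ℤ.drop‿+≤+
  (ℤ.*-cancelʳ-≤-pos (+ m) (+ k) (+ 1) (ℚ.drop-*≤* (fromℚ-cancel-≤ h)))

-- Proper interval representations

module FromRepresentation {G : FiniteSimpleGraph}
  (R : IntervalRepresentation G) (proper : IsProper R) where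
  open FiniteSimpleGraph G
  open IntervalRepresentation R
  open Finite enumeration

  meet⇒overlap : ∀ u v → I u ≬ I v → left u ≤ right v
  meet⇒overlap u v (x , (lu≤x , _) , (_ , x≤rv)) = ≤-trans (left u) x (right v) lu≤x x≤rv

  _≼_ : Rel V 0ℓ
  u ≼ v = left u ≤ left v × right u ≤ right v

  ≼-trans : Transitive _≼_
  ≼-trans {u} {v} {w} (a , b) (c , d) =
    ≤-trans (left u) (left v) (left w) a c , ≤-trans (right u) (right v) (right w) b d

  nested⇒⊆ : ∀ u v → left v ≤ left u → right u ≤ right v → ∀ {x} → I u x → I v x
  nested⇒⊆ u v lv≤lu ru≤rv {x} (lu≤x , x≤ru) =
    ≤-trans (left v) (left u) x lv≤lu lu≤x , ≤-trans x (right u) (right v) x≤ru ru≤rv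

  -- Otherwise `I v` would lie inside `I u` and miss the point `right u`, against properness.
  left≤⇒¬¬right≤ : ∀ u v → left u ≤ left v → ¬ ¬ (right u ≤ right v)
  left≤⇒¬¬right≤ u v lu≤lv ru≰rv = proper v u
    ((λ {x} → nested⇒⊆ v u lu≤lv (≰⇒≥ (right u) (right v) ru≰rv) {x}) ,
     λ Iu⊆Iv → ru≰rv (proj₂ (Iu⊆Iv {right u} (left≤right u , ≤-refl (right u)))))

  module _ (left≤? : Decidable (_≤_ on left)) (right≤? : Decidable (_≤_ on right)) where

    ≼-total : Total _≼_
    ≼-total u v with left≤? u v
    ... | yes lu≤lv =
      inj₁ (lu≤lv , decidable-stable (right≤? u v) (left≤⇒¬¬right≤ u v lu≤lv))
    ... | no lu≰lv =
      inj₂ (lv≤lu , decidable-stable (right≤? v u) (left≤⇒¬¬right≤ v u lv≤lu))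
      where
      lv≤lu : left v ≤ left u
      lv≤lu = ≰⇒≥ (left u) (left v) lu≰lv

    properIntervalOrdering : HasProperIntervalOrdering G
    properIntervalOrdering = preorder⇒properIntervalOrdering G
      (λ u v → left≤? u v ×-dec right≤? u v) ≼-total
      (λ {u} {v} {w} → ≼-trans {u} {v} {w}) between
      where
      ≼-overlap⇒Adj : ∀ {u v} → u ≢ v → left u ≤ left v → left v ≤ right u → Adj u v
      ≼-overlap⇒Adj {u} {v} u≢v lu≤lv lv≤ru =
        Equivalence.from (adjacent⇔intersect u≢v)
          (left v , (lu≤lv , lv≤ru) , (≤-refl (left v) , left≤right v))

      -- Since `I u` meets `I w`, `left w ≤ right u`; monotonicity of both endpoints puts `left v`
      -- before `right u` and `left w` before `right v`.
      between : ∀ u v w → u ≢ v → v ≢ w → u ≼ v → v ≼ w → Adj u w → Adj u v × Adj v w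
      between u v w u≢v v≢w (lu≤lv , ru≤rv) (lv≤lw , rv≤rw) u~w =
        ≼-overlap⇒Adj u≢v lu≤lv (≤-trans (left v) (left w) (right u) lv≤lw lw≤ru) ,
        ≼-overlap⇒Adj v≢w lv≤lw (≤-trans (left w) (right u) (right v) lw≤ru ru≤rv)
        where
        u≢w : u ≢ w
        u≢w u≡w = irrefl u≡w u~w
        lw≤ru : left w ≤ right u
        lw≤ru = meet⇒overlap w u
          (let x , x∈Iu , x∈Iw = Equivalence.to (adjacent⇔intersect u≢w) u~w
           in x , x∈Iw , x∈Iu)

  hasProperIntervalOrdering : HasProperIntervalOrdering G
  hasProperIntervalOrdering = ¬¬⇒hasProperIntervalOrdering G λ none →
    ¬¬-decidable (_≤_ on left) λ left≤? →
    ¬¬-decidable (_≤_ on right) λ right≤? →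
    none (properIntervalOrdering left≤? right≤?)

-- With R(i) the largest position among i and its neighbours, the interval at
-- position i is [n i , n R(i) + i]; the summand i < n makes the right endpoints
-- strictly increasing without creating new intersections.
module ToRepresentation (G : FiniteSimpleGraph) (σ : VertexOrdering G)
  (pio : IsProperIntervalOrdering G σ) where
  open FiniteSimpleGraph G renaming (sym to Adj-sym)
  private module S = Inverse σ

  private
    -- Admitting the position of `v` itself keeps the set nonempty for isolated vertices.
    reachData : ∀ v → ∃[ m ] (m ≡ S.to v ⊎ Adj v (S.from m)) ×
      (∀ k → (k ≡ S.to v ⊎ Adj v (S.from k)) → k Fin.≤ m)
    reachData v = greatest (λ k → k Fin.≟ S.to v ⊎-dec adj? v (S.from k)) (S.to v , inj₁ refl)

  reach : V → Fin order
  reach v = proj₁ (reachData v)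

  reach-self : ∀ v → S.to v Fin.≤ reach v
  reach-self v = proj₂ (proj₂ (reachData v)) (S.to v) (inj₁ refl)

  reach-Adj : ∀ {u v} → Adj u v → S.to v Fin.≤ reach u
  reach-Adj {u} {v} u~v = proj₂ (proj₂ (reachData u)) (S.to v)
    (inj₂ (subst (Adj u) (sym (S.strictlyInverseʳ v)) u~v))

  reach-cases : ∀ v → reach v ≡ S.to v ⊎ ∃[ w ] S.to w ≡ reach v × Adj v w
  reach-cases v = Sum.map₂ (λ a → S.from (reach v) , S.strictlyInverseˡ (reach v) , a)
    (proj₁ (proj₂ (reachData v)))

  to-injective : ∀ {u v} → S.to u ≡ S.to v → u ≡ v
  to-injective = Injection.injective (↔⇒↣ σ)

  -- The farthest neighbour of `u` is at or beyond `v`, so betweenness yields the edge.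
  reach-sound : ∀ {u v} → precedes G σ u v → S.to v Fin.≤ reach u → Adj u v
  reach-sound {u} {v} u<v v≤r with reach-cases u
  ... | inj₁ r≡u = contradiction u<v (ℕ.≤⇒≯ (subst (S.to v Fin.≤_) r≡u v≤r))
  ... | inj₂ (w , w≡r , u~w) with <-cmp (S.to v) (S.to w)
  ...   | tri< v<w _ _ = proj₁ (pio u v w u<v v<w u~w)
  ...   | tri≈ _ v≡w _ = subst (Adj u) (sym (to-injective v≡w)) u~w
  ...   | tri> _ _ w<v = contradiction (subst (S.to v Fin.≤_) (sym w≡r) v≤r) (ℕ.<⇒≱ w<v)

  -- If the farthest neighbour of `u` lies beyond `v`, betweenness makes it a neighbour of `v` too;
  -- otherwise `reach-self` suffices.
  reach-mono : ∀ {u v} → precedes G σ u v → reach u Fin.≤ reach v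
  reach-mono {u} {v} u<v with reach-cases u
  ... | inj₁ r≡u = subst (Fin._≤ reach v) (sym r≡u) (ℕ.≤-trans (ℕ.<⇒≤ u<v) (reach-self v))
  ... | inj₂ (w , w≡r , u~w) = subst (Fin._≤ reach v) w≡r (bound (<-cmp (S.to v) (S.to w)))
    where
    bound : _ → S.to w Fin.≤ reach v
    bound (tri< v<w _ _) = reach-Adj (proj₂ (pio u v w u<v v<w u~w))
    bound (tri≈ _ v≡w _) = subst (Fin._≤ reach v) v≡w (reach-self v)
    bound (tri> _ _ w<v) = ℕ.≤-trans (ℕ.<⇒≤ w<v) (reach-self v)

  l r : V → ℕ
  l v = order ℕ.* toℕ (S.to v)
  r v = order ℕ.* toℕ (reach v) ℕ.+ toℕ (S.to v)

  l-mono : ∀ {u v} → S.to u Fin.≤ S.to v → l u ℕ.≤ l v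
  l-mono = ℕ.*-monoʳ-≤ order

  l-cancel : ∀ u v → l u ℕ.≤ l v → S.to u Fin.≤ S.to v
  l-cancel u v = ℕ.*-cancelˡ-≤ order {{nonZeroIndex (S.to u)}}

  r-cancel : ∀ u v → r u ℕ.≤ r v → S.to u Fin.≤ S.to v
  r-cancel u v ru≤rv = ℕ.≮⇒≥ λ v<u → ℕ.<⇒≱
    (ℕ.+-mono-≤-< (ℕ.*-monoʳ-≤ order (reach-mono v<u)) v<u) ru≤rv

  l≤r⁺ : ∀ {u v} → S.to v Fin.≤ reach u → l v ℕ.≤ r u
  l≤r⁺ v≤r = ℕ.≤-trans (ℕ.*-monoʳ-≤ order v≤r) (ℕ.m≤m+n _ _)

  -- The summand is less than `order`, so `r u` stays below the next multiple of `order` after its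
  -- leading term.
  l≤r⁻ : ∀ u v → l v ℕ.≤ r u → S.to v Fin.≤ reach u
  l≤r⁻ u v lv≤ru = ℕ.≮⇒≥ λ r<v → ℕ.<⇒≱ (beyond r<v) lv≤ru
    where
    open ℕ.≤-Reasoning

    beyond : reach u < S.to v → r u ℕ.< l v
    beyond r<v = begin-strict
      order ℕ.* toℕ (reach u) ℕ.+ toℕ (S.to u) <⟨ ℕ.+-monoʳ-< _ (toℕ<n (S.to u)) ⟩
      order ℕ.* toℕ (reach u) ℕ.+ order        ≡⟨ ℕ.+-comm _ order ⟩
      order ℕ.+ order ℕ.* toℕ (reach u)        ≡⟨ ℕ.*-suc order (toℕ (reach u)) ⟨
      order ℕ.* ℕ.suc (toℕ (reach u))          ≤⟨ ℕ.*-monoʳ-≤ order r<v ⟩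
      l v                                      ∎

  interval : V → Pred ℝ 0ℓ
  interval v = ClosedInterval (fromℕ (l v)) (fromℕ (r v))

  Adj⇒meet : ∀ {u v} → precedes G σ u v → Adj u v → interval u ≬ interval v
  Adj⇒meet {u} {v} u<v u~v = fromℕ (l v) ,
    (fromℕ-mono-≤ (l-mono {u} {v} (ℕ.<⇒≤ u<v)) , fromℕ-mono-≤ (l≤r⁺ {u} {v} (reach-Adj u~v))) ,
    (≤-refl (fromℕ (l v)) , fromℕ-mono-≤ (l≤r⁺ {v} {v} (reach-self v)))

  meet⇒Adj : ∀ {u v} → precedes G σ u v → interval u ≬ interval v → Adj u v
  meet⇒Adj {u} {v} u<v (x , (_ , x≤ru) , (lv≤x , _)) = reach-sound u<v
    (l≤r⁻ u v (fromℕ-cancel-≤ (≤-trans (fromℕ (l v)) x (fromℕ (r u)) lv≤x x≤ru)))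

  ≬-sym : ∀ {u v} → interval u ≬ interval v → interval v ≬ interval u
  ≬-sym (x , p , q) = x , q , p

  adjacent⇔meet : ∀ {u v} → u ≢ v → Adj u v ⇔ (interval u ≬ interval v)
  adjacent⇔meet {u} {v} u≢v with <-cmp (S.to u) (S.to v)
  ... | tri< u<v _ _ = mk⇔ (Adj⇒meet u<v) (meet⇒Adj u<v)
  ... | tri≈ _ u≡v _ = contradiction (to-injective u≡v) u≢v
  ... | tri> _ _ v<u = mk⇔ (≬-sym {v} {u} ∘ Adj⇒meet v<u ∘ Adj-sym)
                             (Adj-sym ∘ meet⇒Adj v<u ∘ ≬-sym {u} {v})

  representation : IntervalRepresentation G
  representation = record
    { left = fromℕ ∘ l
    ; right = fromℕ ∘ r
    ; left≤right = λ v → fromℕ-mono-≤ (l≤r⁺ {v} {v} (reach-self v))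
    ; adjacent⇔intersect = adjacent⇔meet
    }

  -- Both endpoints determine the order of positions, so containment forces `v` to be at most `u` on
  -- the left and at least `u` on the right; hence the intervals coincide.
  representation-proper : IsProper representation
  representation-proper u v (Iu⊆Iv , Iv⊈Iu) =
    Iv⊈Iu λ {x} → subst (λ w → interval w x) v≡u
    where
    lu≤ru : fromℕ (l u) ≤ fromℕ (r u)
    lu≤ru = fromℕ-mono-≤ (l≤r⁺ {u} {u} (reach-self u))

    v≡u : v ≡ u
    v≡u = to-injective (Fin.≤-antisym
      (l-cancel v u (fromℕ-cancel-≤ (proj₁ (Iu⊆Iv {fromℕ (l u)} (≤-refl (fromℕ (l u)) , lu≤ru)))))
      (r-cancel u v (fromℕ-cancel-≤ (proj₂ (Iu⊆Iv {fromℕ (r u)} (lu≤ru , ≤-refl (fromℕ (r u))))))))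

-- The equivalences

properIntervalOrdering⇒properIntervalGraph : ∀ G →
  HasProperIntervalOrdering G → IsProperIntervalGraph G
properIntervalOrdering⇒properIntervalGraph G (σ , pio) =
  representation , λ u v → representation-proper u v
  where open ToRepresentation G σ pio

properIntervalGraph⇒properIntervalOrdering : ∀ G →
  IsProperIntervalGraph G → HasProperIntervalOrdering G
properIntervalGraph⇒properIntervalOrdering G (R , proper) =
  FromRepresentation.hasProperIntervalOrdering R proper

corollary2p9 : (G : FiniteSimpleGraph) →
    (IsClosedGraph G ⇔ HasClosedOrdering G) ×
    (HasClosedOrdering G ⇔ HasProperIntervalOrdering G) ×
    (HasProperIntervalOrdering G ⇔ IsProperIntervalGraph G)
corollary2p9 G =
  -- Adjacency in `relabel G σ` unfolds to adjacency of the listed vertices, so the two notions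
  -- agree by computation.
  mk⇔ id id ,
  mk⇔ (closed⇒properIntervalOrdering G) (properIntervalOrdering⇒closed G) ,
  mk⇔ (properIntervalOrdering⇒properIntervalGraph G)
      (properIntervalGraph⇒properIntervalOrdering G)
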